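{- Let $G$ be an infinite group with identity $e$ and let $G=A_1\cup\dots\cup A_m$. Then there exist $i\in\{1,\dots,m\}$, an injective sequence $(g_n)_{n\in\omega}$ in $G$ with $FP(g_n)_{n\in\omega}\subseteq A_i$, and a subset $X\subseteq FP(g_n)_{n\in\omega}$ such that $\Delta(X)=\{e\}\cup FP(g_n)_{n\in\omega}\cup(FP(g_n)_{n\in\omega})^{ -1}$.
   Context: For $X\subseteq G$, $\Delta(X)=\{g\in G:|gX\cap X|=\infty\}$. For a sequence $(g_n)_{n\in\omega}$, $FP(g_n)_{n\in\omega}$ is the set of all products $g_{i_1}g_{i_2}\cdots g_{i_k}$ with $k\geqslant1$ and $i_1<i_2<\dots<i_k<\omega$. -}

module Defs where

open import Level using (Level; _⊔_)
open import Algebra.Bundles using (Group)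
open import Data.Nat using (ℕ; _<_)
open import Data.List using (List; []; _∷_; foldr)
open import Data.List.Relation.Unary.Linked using (Linked)
open import Data.List.Relation.Unary.Any using (Any)
open import Data.Product using (Σ; ∃; ∃₂; _×_)
open import Data.Sum using (_⊎_)
open import Data.Empty using (⊥)
open import Relation.Nullary using (¬_)

module GroupDefs {c ℓ : Level} (G : Group c ℓ) where
  open Group G

  Finite : ∀ {p} → (Carrier → Set p) → Set (c ⊔ ℓ ⊔ p)
  Finite S = Σ (List Carrier) λ xs → ∀ x → S x → Any (λ y → x ≈ y) xs

  Infinite : ∀ {p} → (Carrier → Set p) → Set (c ⊔ ℓ ⊔ p)
  Infinite S = ¬ Finite S

  InfiniteGroup : Set (c ⊔ ℓ)
  InfiniteGroup = ¬ Finite {c} (λ _ → Carrier)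

  prodIdx : (ℕ → Carrier) → List ℕ → Carrier
  prodIdx g is = foldr (λ i acc → g i ∙ acc) ε is

  FP : (ℕ → Carrier) → Carrier → Set ℓ
  FP g x = ∃₂ λ (i : ℕ) (is : List ℕ) → Linked _<_ (i ∷ is) × (x ≈ prodIdx g (i ∷ is))

  FPinv : (ℕ → Carrier) → Carrier → Set (c ⊔ ℓ)
  FPinv g x = ∃ λ h → FP g h × (x ≈ h ⁻¹)

  translate : ∀ {p} → Carrier → (Carrier → Set p) → Carrier → Set (c ⊔ ℓ ⊔ p)
  translate g X y = ∃ λ x → X x × (y ≈ g ∙ x)

  Δ : ∀ {p} → (Carrier → Set p) → Carrier → Set (c ⊔ ℓ ⊔ p)
  Δ X g = Infinite (λ y → translate g X y × X y)

-- Choose x in G with p x_b ≠ q r⁻¹ s for all p, q, r, s that are products of earlier terms.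
-- Baumgartner's proof of Hindman's theorem yields a sequence g of consecutive block products
-- of x with FP(g) inside one A_i, and g inherits the property of x.
-- Let X consist of g_n and g_F g_n for nonempty finite F and n ∈ N_F, where the infinite sets
-- N_F are disjoint and min N_F > max F. Then g_F, its inverse and e lie in Δ(X).
-- Conversely, two elements of X with equal n have quotient e, g_F or its inverse, while a
-- quotient h = y₀ x₀⁻¹ of elements with distinct n cannot recur at a larger index l:
-- u g_l = h x would be u g_l = y₀ x₀⁻¹ x with x₀, y₀, x products of terms before l.
module Submission where

open import Defs
open import Level using (Level; _⊔_; Lift; lift; lower) renaming (suc to lsuc)
open import Algebra.Bundles using (Group)
open import Axiom.ExcludedMiddle using (ExcludedMiddle)
open import Data.Nat using (ℕ; zero; suc; _+_; _*_; _≤_; _<_; z≤n; s≤s; _≤′_; ≤′-refl; ≤′-step)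
open import Data.Nat.Properties
  using (≤-refl; ≤-trans; ≤-reflexive; <-irrefl; <-cmp; ≤-<-trans; <⇒≤; ≮⇒≥; ≤⇒≤′; n≤1+n; m≤m+n; m≤n+m;
         m≤n*m; +-mono-≤; +-suc; +-identityʳ; suc-injective; *-cancelˡ-≡; even≢odd)
open import Data.Fin using (Fin; toℕ)
open import Data.Fin.Properties using (pigeonhole)
open import Data.List using (List; []; _∷_; _++_; map; cartesianProductWith; length; lookup; allFin)
open import Data.List.Properties using (∷-injective)
open import Data.List.Membership.Propositional using (lose)
open import Data.List.Membership.Propositional.Properties using (∈-allFin)
open import Data.List.Relation.Unary.Any as Any using (Any; here)
open import Data.List.Relation.Unary.Any.Properties using (lookup-index)
open import Data.List.Relation.Unary.Linked using (Linked; [-]; _∷_)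
open import Data.Product using (Σ; ∃; ∃₂; _×_; _,_; proj₁; proj₂)
open import Data.Sum using (_⊎_; inj₁; inj₂)
open import Data.Empty using (⊥)
open import Data.Unit using (⊤; tt)
open import Function using (_∘_)
open import Relation.Nullary using (¬_; Dec; yes; no; contradiction)
open import Relation.Nullary.Decidable using (map′; decidable-stable)
open import Relation.Binary using (tri<; tri≈; tri>)
open import Relation.Binary.PropositionalEquality as ≡ using (_≡_; refl; cong; subst)

-- Injective coding of finite lists of natural numbers.

-- 2 ^ i * (2 * k + 1)
pair : ℕ → ℕ → ℕ
pair zero    k = suc (2 * k)
pair (suc i) k = 2 * pair i k

pair-injective : ∀ i j {k l} → pair i k ≡ pair j l → i ≡ j × k ≡ l
pair-injective zero    zero    {k} {l} eq = refl , *-cancelˡ-≡ k l 2 (suc-injective eq)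
pair-injective zero    (suc j) {k} {l} eq = contradiction (≡.sym eq) (even≢odd (pair j l) k)
pair-injective (suc i) zero    {k} {l} eq = contradiction eq (even≢odd (pair i k) l)
pair-injective (suc i) (suc j) eq
  with i≡j , k≡l ← pair-injective i j (*-cancelˡ-≡ _ _ 2 eq) = cong suc i≡j , k≡l

pair-<ˡ : ∀ i k → i < pair i k
pair-<ˡ zero    k = s≤s z≤n
pair-<ˡ (suc i) k =
  ≤-trans (+-mono-≤ (≤-trans (s≤s z≤n) i<pair) i<pair)
    (≤-reflexive (cong (pair i k +_) (≡.sym (+-identityʳ _))))
  where
  i<pair = pair-<ˡ i k

pair-<ʳ : ∀ i k → k < pair i k
pair-<ʳ zero    k = s≤s (m≤n*m k 2)
pair-<ʳ (suc i) k = ≤-trans (pair-<ʳ i k) (m≤n*m _ 2)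

-- The strict bounds on `pair` make the code of a nonempty list positive, hence distinct from that
-- of `[]`, and larger than every entry. The latter gives min N_F > max F.
code : List ℕ → ℕ
code []       = 0
code (i ∷ is) = pair i (code is)

code-injective : ∀ is js → code is ≡ code js → is ≡ js
code-injective []       []       _  = refl
code-injective []       (j ∷ js) eq =
  contradiction (subst (code js <_) (≡.sym eq) (pair-<ʳ j (code js))) λ ()
code-injective (i ∷ is) []       eq =
  contradiction (subst (code is <_) eq (pair-<ʳ i (code is))) λ ()
code-injective (i ∷ is) (j ∷ js) eq
  with i≡j , eq′ ← pair-injective i j eq = ≡.cong₂ _∷_ i≡j (code-injective is js eq′)

module InGroup {c ℓ : Level} (G : Group c ℓ) where
  open Group G renaming (refl to ≈-refl; sym to ≈-sym; trans to ≈-trans)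
  open GroupDefs G
  open import Algebra.Properties.Group G
  open import Data.List.Membership.Setoid setoid using (_∈_)
  open import Data.List.Membership.Setoid.Properties
  open import Relation.Binary.Reasoning.Setoid setoid using (begin_; _∎; step-≈-⟩; step-≈-⟨)

  -- Products of terms with increasing indices.

  -- Products x i₁ ∙ ⋯ ∙ x iₖ with a ≤ i₁ < ⋯ < iₖ < b; k = 0 is allowed in Span but not in Span⁺.
  data Span (x : ℕ → Carrier) : ℕ → ℕ → Carrier → Set (c ⊔ ℓ) where
    nil  : ∀ {a b z} → a ≤ b → z ≈ ε → Span x a b z
    cons : ∀ {a b i p z} → a ≤ i → Span x (suc i) b p → z ≈ x i ∙ p → Span x a b z

  Span⁺ : (ℕ → Carrier) → ℕ → ℕ → Carrier → Set (c ⊔ ℓ)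
  Span⁺ x a b z = ∃₂ λ i p → a ≤ i × Span x (suc i) b p × z ≈ x i ∙ p

  module _ {x : ℕ → Carrier} where

    Span⁺⇒Span : ∀ {a b z} → Span⁺ x a b z → Span x a b z
    Span⁺⇒Span (_ , _ , a≤i , s , eq) = cons a≤i s eq

    Span-resp : ∀ {a b z w} → z ≈ w → Span x a b z → Span x a b w
    Span-resp z≈w (nil a≤b eq)    = nil a≤b (≈-trans (≈-sym z≈w) eq)
    Span-resp z≈w (cons a≤i s eq) = cons a≤i s (≈-trans (≈-sym z≈w) eq)

    Span⁺-resp : ∀ {a b z w} → z ≈ w → Span⁺ x a b z → Span⁺ x a b w
    Span⁺-resp z≈w (i , p , a≤i , s , eq) = i , p , a≤i , s , ≈-trans (≈-sym z≈w) eq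

    Span-≤ : ∀ {a b z} → Span x a b z → a ≤ b
    Span-≤ (nil a≤b _)    = a≤b
    Span-≤ (cons a≤i s _) = ≤-trans a≤i (≤-trans (n≤1+n _) (Span-≤ s))

    Span⁺-< : ∀ {a b z} → Span⁺ x a b z → a < b
    Span⁺-< (_ , _ , a≤i , s , _) = ≤-trans (s≤s a≤i) (Span-≤ s)

    Span-widenˡ : ∀ {a a′ b z} → a′ ≤ a → Span x a b z → Span x a′ b z
    Span-widenˡ a′≤a (nil a≤b eq)    = nil (≤-trans a′≤a a≤b) eq
    Span-widenˡ a′≤a (cons a≤i s eq) = cons (≤-trans a′≤a a≤i) s eq

    Span-widenʳ : ∀ {a b b′ z} → b ≤ b′ → Span x a b z → Span x a b′ z
    Span-widenʳ b≤b′ (nil a≤b eq)    = nil (≤-trans a≤b b≤b′) eq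
    Span-widenʳ b≤b′ (cons a≤i s eq) = cons a≤i (Span-widenʳ b≤b′ s) eq

    Span⁺-widen : ∀ {a a′ b b′ z} → a′ ≤ a → b ≤ b′ → Span⁺ x a b z → Span⁺ x a′ b′ z
    Span⁺-widen a′≤a b≤b′ (i , p , a≤i , s , eq) =
      i , p , ≤-trans a′≤a a≤i , Span-widenʳ b≤b′ s , eq

    Span⁺-singleton : ∀ i → Span⁺ x i (suc i) (x i)
    Span⁺-singleton i = i , ε , ≤-refl , nil ≤-refl ≈-refl , ≈-sym (identityʳ _)

    Span-++ : ∀ {a b d p q} → Span x a b p → Span x b d q → Span x a d (p ∙ q)
    Span-++ (nil a≤b eq) t =
      Span-resp (≈-sym (≈-trans (∙-congʳ eq) (identityˡ _))) (Span-widenˡ a≤b t)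
    Span-++ (cons a≤i s eq) t = cons a≤i (Span-++ s t) (≈-trans (∙-congʳ eq) (assoc _ _ _))

    Span⁺-++ : ∀ {a b d p q} → Span⁺ x a b p → Span x b d q → Span⁺ x a d (p ∙ q)
    Span⁺-++ (i , p , a≤i , s , eq) t =
      i , p ∙ _ , a≤i , Span-++ s t , ≈-trans (∙-congʳ eq) (assoc _ _ _)

    Span-snoc⁺ : ∀ {a b z} → Span x a b z → Span⁺ x a (suc b) (z ∙ x b)
    Span-snoc⁺ (nil a≤b z≈ε) =
      _ , ε , a≤b , nil ≤-refl ≈-refl ,
      ≈-trans (∙-congʳ z≈ε) (≈-trans (identityˡ _) (≈-sym (identityʳ _)))
    Span-snoc⁺ (cons {p = p} a≤i s eq) =
      _ , p ∙ x _ , a≤i , Span⁺⇒Span (Span-snoc⁺ s) , ≈-trans (∙-congʳ eq) (assoc _ _ _)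

    -- `Span⁺` exposes the smallest index, but genericity and the induction in Hindman's theorem are
    -- governed by the largest one.
    Span⁺-last : ∀ {a b z} → Span⁺ x a b z →
                 ∃₂ λ i p → i < b × Span x a i p × z ≈ p ∙ x i
    Span⁺-last (_ , _ , a≤i , s , eq) = go a≤i s eq
      where
      go : ∀ {a b i p z} → a ≤ i → Span x (suc i) b p → z ≈ x i ∙ p →
           ∃₂ λ j q → j < b × Span x a j q × z ≈ q ∙ x j
      go {i = i} a≤i (nil i<b p≈ε) eq =
        i , ε , i<b , nil a≤i ≈-refl ,
        ≈-trans eq (≈-trans (∙-congˡ p≈ε) (≈-trans (identityʳ _) (≈-sym (identityˡ _))))
      go {i = i} a≤i (cons i<j s eq′) eq with k , q , k<b , t , eq″ ← go i<j s eq′ =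
        k , x i ∙ q , k<b , cons a≤i t ≈-refl ,
        ≈-trans eq (≈-trans (∙-congˡ eq″) (≈-sym (assoc _ _ _)))

    Span⁺⇒FP : ∀ {a b z} → Span⁺ x a b z → FP x z
    Span⁺⇒FP (i , _ , _ , s , eq) = let is , o , eq′ = go s eq in i , is , o , eq′
      where
      go : ∀ {b i p z} → Span x (suc i) b p → z ≈ x i ∙ p →
           ∃ λ is → Linked _<_ (i ∷ is) × z ≈ prodIdx x (i ∷ is)
      go (nil _ p≈ε) eq = [] , [-] , ≈-trans eq (∙-congˡ p≈ε)
      go (cons {i = j} i<j s eq′) eq with js , o , eq″ ← go s eq′ =
        j ∷ js , i<j ∷ o , ≈-trans eq (∙-congˡ eq″)

  spans : (ℕ → Carrier) → ℕ → List Carrier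
  spans x zero    = ε ∷ []
  spans x (suc b) = spans x b ++ map (_∙ x b) (spans x b)

  spans-mono : ∀ x {a b z} → a ≤′ b → z ∈ spans x a → z ∈ spans x b
  spans-mono x ≤′-refl       = λ z∈ → z∈
  spans-mono x (≤′-step a≤b) = ∈-++⁺ˡ setoid ∘ spans-mono x a≤b

  Span⇒∈spans : ∀ {x b z} → Span x 0 b z → z ∈ spans x b
  Span⇒∈spans {x} s = ∈-resp-≈ setoid (identityˡ _) (extend (here ≈-refl) s)
    where
    -- `Span` is read from its first factor while `spans` adds the last one, so the induction
    -- carries the product `l` of the factors already read.
    extend : ∀ {a b l z} → l ∈ spans x a → Span x a b z → l ∙ z ∈ spans x b
    extend l∈ (nil a≤b eq) =
      ∈-resp-≈ setoid (≈-sym (≈-trans (∙-congˡ eq) (identityʳ _))) (spans-mono x (≤⇒≤′ a≤b) l∈)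
    extend l∈ (cons {i = i} a≤i s eq) =
      ∈-resp-≈ setoid (≈-trans (assoc _ _ _) (∙-congˡ (≈-sym eq)))
        (extend (∈-++⁺ʳ setoid (spans x i)
                  (∈-map⁺ setoid setoid (∙-congʳ) (spans-mono x (≤⇒≤′ a≤i) l∈))) s)

  -- Block sequences.

  -- y is a sequence of products of x over consecutive nonempty blocks of indices.
  record _⊑_ (y x : ℕ → Carrier) : Set (c ⊔ ℓ) where
    field
      cut   : ℕ → ℕ
      block : ∀ n → Span⁺ x (cut n) (cut (suc n)) (y n)

    cut-mono : ∀ {m n} → m ≤ n → cut m ≤ cut n
    cut-mono = go ∘ ≤⇒≤′
      where
      go : ∀ {m n} → m ≤′ n → cut m ≤ cut n
      go ≤′-refl       = ≤-refl
      go (≤′-step m≤n) = ≤-trans (go m≤n) (<⇒≤ (Span⁺-< (block _)))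

    push : ∀ {a b z} → Span y a b z → Span x (cut a) (cut b) z
    push (nil a≤b eq)    = nil (cut-mono a≤b) eq
    push (cons a≤i s eq) =
      Span-resp (≈-sym eq)
        (Span-widenˡ (cut-mono a≤i) (Span-++ (Span⁺⇒Span (block _)) (push s)))

    push⁺ : ∀ {a b z} → Span⁺ y a b z → Span⁺ x (cut a) (cut b) z
    push⁺ (i , p , a≤i , s , eq)
      with j , q , i≤j , t , eq′ ← Span⁺-++ (block i) (push s) =
      j , q , ≤-trans (cut-mono a≤i) i≤j , t , ≈-trans eq eq′

  open _⊑_

  ⊑-trans : ∀ {x y z} → z ⊑ y → y ⊑ x → z ⊑ x
  ⊑-trans z⊑y y⊑x = record { cut = cut y⊑x ∘ cut z⊑y ; block = push⁺ y⊑x ∘ block z⊑y }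

  ⊑-refl : ∀ {x} → x ⊑ x
  ⊑-refl = record { cut = λ n → n ; block = Span⁺-singleton }

  ⊑-shift : ∀ {x} b → (λ n → x (n + b)) ⊑ x
  ⊑-shift b = record { cut = _+ b ; block = λ n → Span⁺-singleton (n + b) }

  -- Generic sequences.

  Generic : (ℕ → Carrier) → Set (c ⊔ ℓ)
  Generic x = ∀ {b p q r s} → Span x 0 b p → Span x 0 b q → Span x 0 b r → Span x 0 b s →
              ¬ p ∙ x b ≈ (q // r) ∙ s

  -- Let `x i` be the last factor of the block `y b`. What precedes it in the block joins the left
  -- factor `p`, and products of earlier terms of `y` use only indices of `x` below `cut b`, which
  -- is at most `i`.
  Generic-⊑ : ∀ {x y} → y ⊑ x → Generic x → Generic y
  Generic-⊑ y⊑x gen {b} sp sq sr ss eq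
    with i , p′ , _ , t , eq′ ← Span⁺-last (block y⊑x b) =
    gen (Span-++ (from0 sp) t) (below sq) (below sr) (below ss)
        (≈-trans (assoc _ _ _) (≈-trans (∙-congˡ (≈-sym eq′)) eq))
    where
    from0 : ∀ {z} → Span _ 0 b z → Span _ 0 (cut y⊑x b) z
    from0 = Span-widenˡ z≤n ∘ push y⊑x
    below : ∀ {z} → Span _ 0 b z → Span _ 0 i z
    below = Span-widenʳ (Span-≤ t) ∘ from0

  Generic⇒≉ : ∀ {x j k} → Generic x → j < k → ¬ x k ≈ x j
  Generic⇒≉ {x} {j} {k} gen j<k eq =
    -- With `q = x j` and the other three products trivial, the excluded equation is `x k ≈ x j`.
    gen εₛ (Span-widenˡ z≤n (Span-widenʳ j<k (Span⁺⇒Span (Span⁺-singleton j)))) εₛ εₛ (begin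
      ε ∙ x k          ≈⟨ identityˡ _ ⟩
      x k              ≈⟨ eq ⟩
      x j              ≈⟨ identityʳ _ ⟨
      x j ∙ ε          ≈⟨ ∙-congˡ ε⁻¹≈ε ⟨
      x j // ε         ≈⟨ identityʳ _ ⟨
      (x j // ε) ∙ ε   ∎)
    where
    εₛ : Span x 0 k ε
    εₛ = nil z≤n ≈-refl

  Generic⇒injective : ∀ {x} → Generic x → ∀ j k → x j ≈ x k → j ≡ k
  Generic⇒injective {x} gen j k eq with <-cmp j k
  ... | tri< j<k _ _ = contradiction (≈-sym eq) (Generic⇒≉ gen j<k)
  ... | tri≈ _ j≡k _ = j≡k
  ... | tri> _ _ k<j = contradiction eq (Generic⇒≉ gen k<j)

  injective⇒infinite : ∀ {p} {S : Carrier → Set p} (f : ℕ → Carrier) →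
    (∀ j k → f j ≈ f k → j ≡ k) → (∀ n → S (f n)) → Infinite S
  injective⇒infinite f inj f∈S (xs , covers) =
    let found = λ (n : Fin (suc (length xs))) → covers (f (toℕ n)) (f∈S (toℕ n))
        i , j , i<j , eq = pigeonhole ≤-refl (Any.index ∘ found)
        fi≈fj = ≈-trans (lookup-index (found i))
                  (≈-trans (reflexive (cong (lookup xs) eq)) (≈-sym (lookup-index (found j))))
    in <-irrefl (inj _ _ fi≈fj) i<j

  -- Baumgartner's large sets.

  -- This form of largeness passes to block sequences and, by `Large-split`, to one part of a finite
  -- cover.
  Large : ∀ {p} → (Carrier → Set p) → (ℕ → Carrier) → Set (c ⊔ ℓ ⊔ p)
  Large K x = ∀ {y} → y ⊑ x → ∃₂ λ b z → Span⁺ y 0 b z × K z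

  Large-⊑ : ∀ {p} {K : Carrier → Set p} {x y} → y ⊑ x → Large K x → Large K y
  Large-⊑ y⊑x large z⊑y = large (⊑-trans z⊑y y⊑x)

  Large-map : ∀ {p q} {K : Carrier → Set p} {K′ : Carrier → Set q} {x} →
              (∀ {z} → K z → K′ z) → Large K x → Large K′ x
  Large-map f large y⊑x = let b , z , s , k = large y⊑x in b , z , s , f k

  module Hindman {a : Level} (em : ExcludedMiddle (a ⊔ c ⊔ ℓ)) where

    decide : (P : Set (c ⊔ ℓ)) → Dec P
    decide P = map′ lower lift (em {Lift a P})

    Predicate : Set (lsuc (a ⊔ c ⊔ ℓ))
    Predicate = Carrier → Set (a ⊔ c ⊔ ℓ)

    Large-or-avoidable : (K : Predicate) (x : ℕ → Carrier) →
      Large K x ⊎ ∃ λ y → y ⊑ x × (∀ {b z} → Span⁺ y 0 b z → ¬ K z)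
    Large-or-avoidable K x with em {∃ λ y → y ⊑ x × (∀ {b z} → Span⁺ y 0 b z → ¬ K z)}
    ... | yes avoid = inj₂ avoid
    ... | no  none  = inj₁ λ {y} y⊑x → decidable-stable em λ ¬hit →
                        none (y , y⊑x , λ s k → ¬hit (_ , _ , s , k))

    -- Either the first part is already large, or some block sequence avoids it, and there the
    -- remaining parts still cover `K`. The list cannot run out, since `K` stays large.
    Large-split : ∀ {d} {D : Set d} (P : D → Predicate) (ds : List D) {K : Predicate} {x} →
      Large K x → (∀ {b z} → Span⁺ x 0 b z → K z → Any (λ d → P d z) ds) →
      ∃₂ λ d y → y ⊑ x × Large (P d) y
    Large-split P [] large split
      with _ , _ , s , k ← large ⊑-refl
      with () ← split s k
    Large-split P (d ∷ ds) {x = x} large split with Large-or-avoidable (P d) x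
    ... | inj₁ large-d = d , x , ⊑-refl , large-d
    ... | inj₂ (y , y⊑x , avoid)
      with e , y′ , y′⊑y , large-e ← Large-split P ds (Large-⊑ y⊑x large)
             (λ s k → Any.tail (avoid s) (split (Span⁺-widen z≤n ≤-refl (push⁺ y⊑x s)) k)) =
      e , y′ , ⊑-trans y′⊑y y⊑x , large-e

    -- One step of Baumgartner's construction.

    module _ {K : Predicate} (K-resp : ∀ {z w} → z ≈ w → K z → K w) where

      -- If no b works, then chain the counterexamples w, each preceded by the term of x just before it,
      -- so that every product, even of one factor, has the form d ∙ w with d a nonempty product.
      Large⇒covered : ∀ {x} → Large K x →
        ∃ λ b → ∀ {b′ w} → Span⁺ x b b′ w → ∃ λ d → Span⁺ x 0 b d × K (d ∙ w)
      Large⇒covered {x} large = decidable-stable em λ none →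
        let bad : ∀ b → ∃₂ λ b′ w → Span⁺ x b b′ w × (∀ d → Span⁺ x 0 b d → ¬ K (d ∙ w))
            bad b = decidable-stable em λ ¬bad →
              none (b , λ {b′} {w} s → decidable-stable em λ ¬hit →
                ¬bad (b′ , w , s , λ d t k → ¬hit (d , t , k)))
            open Chain bad
            _ , z , (_ , _ , 0≤i , s , eq) , k = large y⊑x
        in y-avoids (nil ≤-refl ≈-refl) 0≤i s eq (K-resp (≈-sym (identityˡ z)) k)
        where
        module Chain (bad : ∀ b → ∃₂ λ b′ w → Span⁺ x b b′ w × (∀ d → Span⁺ x 0 b d → ¬ K (d ∙ w))) where
          next : ℕ → ℕ
          next b = proj₁ (bad (suc b))

          w : ℕ → Carrier
          w b = proj₁ (proj₂ (bad (suc b)))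

          mark : ℕ → ℕ
          mark zero    = 0
          mark (suc n) = next (mark n)

          y : ℕ → Carrier
          y n = x (mark n) ∙ w (mark n)

          y⊑x : y ⊑ x
          y⊑x = record
            { cut   = mark
            ; block = λ n → Span⁺-++ (Span⁺-singleton _)
                              (Span⁺⇒Span (proj₁ (proj₂ (proj₂ (bad (suc (mark n)))))))
            }

          -- The induction walks to the last factor `y i` of the product and collects in `p` all
          -- factors passed. Then `bad` applies with `p ∙ x (mark i)` in the role of `d`.
          y-avoids : ∀ {a b i p q z} → Span x 0 (mark a) p →
                     a ≤ i → Span y (suc i) b q → z ≈ y i ∙ q → ¬ K (p ∙ z)
          y-avoids {i = i} {p} {q} {z} sp a≤i (nil _ q≈ε) eq k =
            proj₂ (proj₂ (proj₂ (bad (suc (mark i))))) _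
              (Span-snoc⁺ (Span-widenʳ (cut-mono y⊑x a≤i) sp))
              (K-resp (begin
                p ∙ z                             ≈⟨ ∙-congˡ (≈-trans eq (∙-congˡ q≈ε)) ⟩
                p ∙ (y i ∙ ε)                     ≈⟨ ∙-congˡ (identityʳ _) ⟩
                p ∙ (x (mark i) ∙ w (mark i))     ≈⟨ assoc _ _ _ ⟨
                (p ∙ x (mark i)) ∙ w (mark i)     ∎) k)
          y-avoids {i = i} sp a≤i (cons i<j s eq′) eq k =
            y-avoids (Span-++ (Span-widenʳ (cut-mono y⊑x a≤i) sp) (Span⁺⇒Span (block y⊑x i)))
              i<j s eq′ (K-resp (≈-trans (∙-congˡ eq) (≈-sym (assoc _ _ _))) k)

      record Extension (x : ℕ → Carrier) : Set (a ⊔ c ⊔ ℓ) where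
        field
          rest   : ℕ → Carrier
          rest⊑  : rest ⊑ x
          first  : Carrier
          first⁺ : Span⁺ x 0 (cut rest⊑ 0) first
          large  : Large (λ w → K w × K (first ∙ w)) rest

      opaque
        -- Every product `w` of terms from index `b` on has a partner `d`, a product of terms before
        -- `b`, with `d ∙ w` in `K`. Only finitely many `d` are available, so splitting `K`
        -- according to the partner leaves one `d` that serves a large set.
        extend : ∀ {x} → Large K x → Extension x
        extend {x} large
          with b , covered ← Large⇒covered large
          with d , y , y⊑tail , large-d ←
                 Large-split (λ d w → Span⁺ x 0 b d × K w × K (d ∙ w)) (spans x b)
                   (Large-⊑ (⊑-shift b) large)
                   (λ s k →
                     let d , sd , k′ = covered (push⁺ (⊑-shift b) s)
                     in Any.map (λ d≈e → Span⁺-resp d≈e sd , k , K-resp (∙-congʳ d≈e) k′)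
                          (Span⇒∈spans (Span⁺⇒Span sd)))
          -- The list `spans x b` also contains ε. That `d` is a nonempty product is read off from
          -- any element of the large set.
          with _ , _ , _ , sd , _ ← large-d ⊑-refl = record
          { rest   = y
          ; rest⊑  = ⊑-trans y⊑tail (⊑-shift b)
          ; first  = d
          ; first⁺ = Span⁺-widen ≤-refl (m≤n+m b _) sd
          ; large  = Large-map proj₂ large-d
          }

    -- Iteration of the step and Hindman's theorem.

    record Stage : Set (lsuc (a ⊔ c ⊔ ℓ)) where
      field
        K     : Predicate
        resp  : ∀ {z w} → z ≈ w → K z → K w
        seq   : ℕ → Carrier
        large : Large K seq

      extension : Extension resp seq
      extension = extend resp large

      open Extension extension public hiding (large)

      next : Stage
      next = record
        { K     = λ w → K w × K (first ∙ w)
        ; resp  = λ z≈w (k , k′) → resp z≈w k , resp (∙-congˡ z≈w) k′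
        ; seq   = rest
        ; large = Extension.large extension
        }

    stage : Stage → ℕ → Stage
    stage s zero    = s
    stage s (suc n) = Stage.next (stage s n)

    hindman : (s : Stage) → ∃ λ y → y ⊑ Stage.seq s × (∀ {b z} → Span⁺ y 0 b z → Stage.K s z)
    hindman s = y , ⊑-trans y⊑d d⊑x , y⊆K
      where
      module S n = Stage (stage s n)
      open S using (K)

      d : ℕ → Carrier
      d = S.first

      -- The index in the sequence of stage `n` at which the block for `d (k + n)` begins.
      pos : ℕ → ℕ → ℕ
      pos n zero    = 0
      pos n (suc k) = cut (S.rest⊑ n) (pos (suc n) k)

      -- The separate `m` absorbs the passage from `suc k + n` to `k + suc n` in the recursion.
      d-block : ∀ n k {m} → k + n ≡ m → Span⁺ (S.seq n) (pos n k) (pos n (suc k)) (d m)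
      d-block n zero    refl = S.first⁺ n
      d-block n (suc k) eq   = push⁺ (S.rest⊑ n) (d-block (suc n) k (≡.trans (+-suc k n) eq))

      d-tail⊑ : ∀ n → (λ k → d (k + n)) ⊑ S.seq n
      d-tail⊑ n = record { cut = pos n ; block = λ k → d-block n k refl }

      d⊑x : d ⊑ Stage.seq s
      d⊑x = record { cut = pos 0 ; block = λ k → d-block 0 k (+-identityʳ k) }

      K-anti : ∀ {m n w} → m ≤′ n → K n w → K m w
      K-anti ≤′-refl       k = k
      K-anti (≤′-step m≤n) k = K-anti m≤n (proj₁ k)

      -- Factors are prepended from the last to the first. Prepending `d i` leads from `K (suc i)`
      -- to `K i`, by the definition of the next stage, and skipped stages are crossed because the
      -- sets decrease.
      K-∙ : ∀ {m n p w} → K n w → Span d m n p → K m (p ∙ w)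
      K-∙ {m} k (nil m≤n p≈ε) =
        S.resp m (≈-sym (≈-trans (∙-congʳ p≈ε) (identityˡ _))) (K-anti (≤⇒≤′ m≤n) k)
      K-∙ {m} k (cons m≤i s eq) =
        S.resp m (≈-sym (≈-trans (∙-congʳ eq) (assoc _ _ _)))
          (K-anti (≤⇒≤′ m≤i) (proj₂ (K-∙ k s)))

      -- The terms of d need not lie in K 0, but z ∈ K n does, and so does p ∙ z for p a product of
      -- terms of d below n; hence y is assembled from such z.
      hit : ∀ n → ∃₂ λ b z → Span⁺ d n b z × K n z
      hit n = let b , z , t , k = S.large n (d-tail⊑ n)
              in b + n , z , push⁺ (⊑-shift n) t , k

      mark : ℕ → ℕ
      mark zero    = 0
      mark (suc n) = proj₁ (hit (mark n))

      y : ℕ → Carrier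
      y n = proj₁ (proj₂ (hit (mark n)))

      y⊑d : y ⊑ d
      y⊑d = record { cut = mark ; block = λ n → proj₁ (proj₂ (proj₂ (hit (mark n)))) }

      -- The last factor `y i` lies in `K (mark i)`, and the factors before it multiply to a product
      -- of terms of `d` below `mark i`.
      y⊆K : ∀ {b z} → Span⁺ y 0 b z → K 0 z
      y⊆K t with i , p , _ , u , eq ← Span⁺-last t =
        S.resp 0 (≈-sym eq) (K-∙ (proj₂ (proj₂ (proj₂ (hit (mark i))))) (push y⊑d u))

    -- Existence of a generic sequence.

    module _ (G-infinite : InfiniteGroup) where

      fresh : (xs : List Carrier) → ∃ λ z → ¬ z ∈ xs
      fresh xs = decidable-stable (decide _) λ ¬fresh →
        G-infinite (xs , λ z _ → decidable-stable (decide _) λ z∉ → ¬fresh (z , z∉))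

      -- The solutions `z` of p z = q r⁻¹ s with p, q, r, s in `l`.
      forbidden : List Carrier → List Carrier
      forbidden l =
        cartesianProductWith _\\_ l (cartesianProductWith _∙_ (cartesianProductWith _//_ l l) l)

      -- Each new term depends on all earlier products, so the recursion runs on the list of
      -- products. It is identified with `spans generic` afterwards.
      history : ℕ → List Carrier
      history zero    = ε ∷ []
      history (suc b) = history b ++ map (_∙ proj₁ (fresh (forbidden (history b)))) (history b)

      generic : ℕ → Carrier
      generic b = proj₁ (fresh (forbidden (history b)))

      spans-generic : ∀ b → spans generic b ≡ history b
      spans-generic zero    = refl
      spans-generic (suc b) = ≡.cong (λ l → l ++ map (_∙ generic b) l) (spans-generic b)

      generic-Generic : Generic generic
      generic-Generic {b} {p} sp sq sr ss eq =
        proj₂ (fresh (forbidden (history b)))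
          (∈-resp-≈ setoid (≈-trans (\\-cong₂ ≈-refl (≈-sym eq)) (\\-leftDividesʳ p (generic b)))
            (∈-cartesianProductWith⁺ setoid setoid setoid \\-cong₂ (in-history sp)
              (∈-cartesianProductWith⁺ setoid setoid setoid ∙-cong
                (∈-cartesianProductWith⁺ setoid setoid setoid //-cong₂ (in-history sq) (in-history sr))
                (in-history ss))))
        where
        in-history : ∀ {z} → Span generic 0 b z → z ∈ history b
        in-history {z} s = subst (z ∈_) (spans-generic b) (Span⇒∈spans s)

    -- The set X and the computation of Δ(X).

    module Witness (g : ℕ → Carrier) (gen : Generic g) where

      g-injective : ∀ j k → g j ≈ g k → j ≡ k
      g-injective = Generic⇒injective gen

      -- The code of a list exceeds its entries and so bounds the indices. In `X.prefix` this places
      -- g_F before the term with index in N_F.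
      Linked⇒Span⁺ : ∀ {b} i is → code (i ∷ is) ≤ b → Linked _<_ (i ∷ is) →
                     Span⁺ g i b (prodIdx g (i ∷ is))
      Linked⇒Span⁺ i [] code≤b _ =
        i , ε , ≤-refl , nil (≤-trans (pair-<ˡ i 0) code≤b) ≈-refl , ≈-refl
      Linked⇒Span⁺ i (j ∷ js) code≤b (i<j ∷ o) =
        i , _ , ≤-refl ,
        Span-widenˡ i<j (Span⁺⇒Span
          (Linked⇒Span⁺ j js (≤-trans (<⇒≤ (pair-<ʳ i (code (j ∷ js)))) code≤b) o)) ,
        ≈-refl

      FP⇒Span⁺ : ∀ {z} → FP g z → ∃ λ b → Span⁺ g 0 b z
      FP⇒Span⁺ (i , is , o , eq) =
        code (i ∷ is) , Span⁺-resp (≈-sym eq) (Span⁺-widen z≤n ≤-refl (Linked⇒Span⁺ i is ≤-refl o))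

      -- N_F is realised as { code (j ∷ F) | j ∈ ℕ }.
      record X (z : Carrier) : Set (c ⊔ ℓ) where
        constructor mkX
        field
          j i     : ℕ
          is      : List ℕ
          ordered : Linked _<_ (i ∷ is)
          u       : Carrier
          u≈      : u ≈ ε ⊎ u ≈ prodIdx g (i ∷ is)
          z≈      : z ≈ u ∙ g (code (j ∷ i ∷ is))

        index : ℕ
        index = code (j ∷ i ∷ is)

        prefix : Span g 0 index u
        prefix with u≈
        ... | inj₁ u≈ε = nil z≤n u≈ε
        ... | inj₂ u≈F = Span-resp (≈-sym u≈F) (Span-widenˡ z≤n
                           (Span⁺⇒Span (Linked⇒Span⁺ i is (<⇒≤ (pair-<ʳ j (code (i ∷ is)))) ordered)))

        span⁺ : Span⁺ g 0 (suc index) z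
        span⁺ = Span⁺-resp (≈-sym z≈) (Span-snoc⁺ prefix)

        span : ∀ {b} → index < b → Span g 0 b z
        span index<b = Span-widenʳ index<b (Span⁺⇒Span span⁺)

      open X using (index; span)

      Target : Carrier → Set (c ⊔ ℓ)
      Target h = h ≈ ε ⊎ FP g h ⊎ FPinv g h

      -- Equal codes give the same F, and cancelling the common last factor leaves v = h u with u
      -- and v in {e, g_F}. The four cases yield e, g_F, g_F⁻¹ and e.
      same-index : ∀ {h x y} (x∈ : X x) (y∈ : X y) → y ≈ h ∙ x → index x∈ ≡ index y∈ → Target h
      same-index {h} {x} {y} (mkX j i is o u u≈ x≈) (mkX j′ i′ is′ _ v v≈ y≈) y≈hx same
        with refl ← code-injective (j ∷ i ∷ is) (j′ ∷ i′ ∷ is′) same = target u≈ v≈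
        where
        v≈hu : v ≈ h ∙ u
        v≈hu = ∙-cancelʳ _ _ _ (begin
          v ∙ g n         ≈⟨ y≈ ⟨
          y               ≈⟨ y≈hx ⟩
          h ∙ x           ≈⟨ ∙-congˡ x≈ ⟩
          h ∙ (u ∙ g n)   ≈⟨ assoc _ _ _ ⟨
          (h ∙ u) ∙ g n   ∎)
          where
          n = code (j ∷ i ∷ is)

        F = prodIdx g (i ∷ is)

        h≈v : u ≈ ε → h ≈ v
        h≈v u≈ε = ≈-trans (≈-sym (≈-trans (∙-congˡ u≈ε) (identityʳ h))) (≈-sym v≈hu)

        hF≈v : u ≈ F → h ∙ F ≈ v
        hF≈v u≈F = ≈-trans (∙-congˡ (≈-sym u≈F)) (≈-sym v≈hu)

        target : u ≈ ε ⊎ u ≈ F → v ≈ ε ⊎ v ≈ F → Target h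
        target (inj₁ u≈ε) (inj₁ v≈ε) = inj₁ (≈-trans (h≈v u≈ε) v≈ε)
        target (inj₁ u≈ε) (inj₂ v≈F) = inj₂ (inj₁ (i , is , o , ≈-trans (h≈v u≈ε) v≈F))
        target (inj₂ u≈F) (inj₁ v≈ε) =
          inj₂ (inj₂ (F , (i , is , o , ≈-refl) , inverseˡ-unique _ _ (≈-trans (hF≈v u≈F) v≈ε)))
        target (inj₂ u≈F) (inj₂ v≈F) = inj₁ (identityˡ-unique _ _ (≈-trans (hF≈v u≈F) v≈F))

      no-late-quotient : ∀ {h x y x₀ y₀} (x∈ : X x) (y∈ : X y) → y ≈ h ∙ x → y₀ ≈ h ∙ x₀ →
        index x∈ < index y∈ → Span g 0 (index y∈) x₀ → Span g 0 (index y∈) y₀ → ⊥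
      no-late-quotient {h} {x} {y} {x₀} {y₀} x∈ y∈ y≈hx y₀≈hx₀ x<y sx₀ sy₀ =
        gen (X.prefix y∈) sy₀ sx₀ (span x∈ x<y) (begin
          X.u y∈ ∙ g (index y∈)   ≈⟨ X.z≈ y∈ ⟨
          y                       ≈⟨ y≈hx ⟩
          h ∙ x                   ≈⟨ ∙-congʳ (x≈z//y h x₀ y₀ (≈-sym y₀≈hx₀)) ⟩
          (y₀ // x₀) ∙ x          ∎)

      Δ⇒Target : ∀ h → Δ X h → Target h
      Δ⇒Target h infinite = decidable-stable (decide _) λ ¬target → infinite (finite ¬target)
        where
        swap : ∀ {x y} → y ≈ h ∙ x → x ≈ h ⁻¹ ∙ y
        swap = y≈x\\z _ _ _ ∘ ≈-sym

        finite : ¬ Target h → Finite (λ y → translate h X y × X y)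
        finite ¬target with decide (∃ λ y → translate h X y × X y)
        ... | no  none = [] , λ y y∈ → contradiction (y , y∈) none
        -- One pair y₀ = h x₀ determines h. Its indices are at most `l`, and every element of hX ∩ X
        -- turns out to have index at most `l` too, so the products of terms up to `l` cover this
        -- set.
        ... | yes (y₀ , (x₀ , x₀∈ , y₀≈) , y₀∈) =
          spans g (suc l) , λ { y ((x , x∈ , y≈) , y∈) →
            Span⇒∈spans (span y∈ (s≤s (≮⇒≥ (bounded x∈ y∈ y≈)))) }
          where
          l = index x₀∈ + index y₀∈

          sx₀ : ∀ {b} → l < b → Span g 0 b x₀
          sx₀ l<b = span x₀∈ (≤-<-trans (m≤m+n _ _) l<b)

          sy₀ : ∀ {b} → l < b → Span g 0 b y₀
          sy₀ l<b = span y₀∈ (≤-<-trans (m≤n+m _ _) l<b)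

          bounded : ∀ {x y} (x∈ : X x) (y∈ : X y) → y ≈ h ∙ x → ¬ l < index y∈
          bounded x∈ y∈ y≈hx l<y with <-cmp (index x∈) (index y∈)
          ... | tri< x<y _ _ = no-late-quotient x∈ y∈ y≈hx y₀≈ x<y (sx₀ l<y) (sy₀ l<y)
          ... | tri≈ _ x≡y _ = ¬target (same-index x∈ y∈ y≈hx x≡y)
          -- Now x has the larger index, so the roles are exchanged and h is replaced by its
          -- inverse.
          ... | tri> _ _ y<x =
            let l<x = ≤-<-trans (<⇒≤ l<y) y<x
            in no-late-quotient y∈ x∈ (swap y≈hx) (swap y₀≈) y<x (sy₀ l<x) (sx₀ l<x)

      -- Infinitely many coincidences for e, g_F and its inverse.

      module _ (i : ℕ) (is : List ℕ) (o : Linked _<_ (i ∷ is)) where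

        private
          F = prodIdx g (i ∷ is)

        single : ℕ → Carrier
        single j = g (code (j ∷ i ∷ is))

        single∈X : ∀ j → X (single j)
        single∈X j = mkX j i is o ε (inj₁ ≈-refl) (≈-sym (identityˡ _))

        shifted∈X : ∀ j → X (F ∙ single j)
        shifted∈X j = mkX j i is o F (inj₂ ≈-refl) ≈-refl

        single-injective : ∀ j k → single j ≈ single k → j ≡ k
        single-injective j k eq =
          proj₁ (∷-injective (code-injective (j ∷ i ∷ is) (k ∷ i ∷ is) (g-injective _ _ eq)))

        ε∈Δ : ∀ {h} → h ≈ ε → Δ X h
        ε∈Δ h≈ε = injective⇒infinite single single-injective λ j →
          (single j , single∈X j , ≈-sym (≈-trans (∙-congʳ h≈ε) (identityˡ _))) , single∈X j

        F∈Δ : ∀ {h} → h ≈ F → Δ X h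
        F∈Δ h≈F = injective⇒infinite (λ j → F ∙ single j)
          (λ j k eq → single-injective j k (∙-cancelˡ _ _ _ eq)) λ j →
          (single j , single∈X j , ∙-congʳ (≈-sym h≈F)) , shifted∈X j

        F⁻¹∈Δ : ∀ {h} → h ≈ F ⁻¹ → Δ X h
        F⁻¹∈Δ h≈F⁻¹ = injective⇒infinite single single-injective λ j →
          (F ∙ single j , shifted∈X j ,
           ≈-sym (≈-trans (∙-congʳ h≈F⁻¹) (\\-leftDividesʳ F (single j)))) , single∈X j

      Target⇒Δ : ∀ h → Target h → Δ X h
      -- Any F serves for the identity; F = {0} is taken.
      Target⇒Δ h (inj₁ h≈ε)                                     = ε∈Δ 0 [] [-] h≈ε
      Target⇒Δ h (inj₂ (inj₁ (i , is , o , h≈F)))               = F∈Δ i is o h≈F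
      Target⇒Δ h (inj₂ (inj₂ (f , (i , is , o , f≈F) , h≈f⁻¹))) =
        F⁻¹∈Δ i is o (≈-trans h≈f⁻¹ (⁻¹-cong f≈F))

theorem5p2 : ∀ {c ℓ a : Level} → ExcludedMiddle (a ⊔ c ⊔ ℓ) →
    (G : Group c ℓ) → let open Group G in let open GroupDefs G in
    InfiniteGroup →
    (m : ℕ) (A : Fin m → Carrier → Set a) →
    (∀ i {x y} → x ≈ y → A i x → A i y) →
    (∀ x → Σ (Fin m) λ i → A i x) →
    Σ (Fin m) λ i → Σ (ℕ → Carrier) λ g →
    (∀ j k → g j ≈ g k → j ≡ k) ×
    (∀ x → FP g x → A i x) ×
    Σ (Carrier → Set (c ⊔ ℓ)) λ X →
    (∀ x → X x → FP g x) ×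
    (∀ h → (Δ X h → (h ≈ ε ⊎ FP g h ⊎ FPinv g h)) × ((h ≈ ε ⊎ FP g h ⊎ FPinv g h) → Δ X h))
theorem5p2 {c} {ℓ} {a} em G G-infinite m A A-resp cover =
  i , g , g-injective ,
  (λ x x∈ → lower (g⊆A (proj₂ (FP⇒Span⁺ x∈)))) ,
  X , (λ x x∈ → Span⁺⇒FP (X.span⁺ x∈)) , λ h → Δ⇒Target h , Target⇒Δ h
  where
  open InGroup G
  open Hindman {a} em

  colour : Fin m → Predicate
  colour i z = Lift (c ⊔ ℓ) (A i z)

  x = generic G-infinite

  -- The whole group is large for `x`, and the colours cover it, so one colour class is large for
  -- some block sequence of `x`.
  monochromatic : ∃₂ λ i y → y ⊑ x × Large (colour i) y
  monochromatic = Large-split colour (allFin m) {K = λ _ → Lift _ ⊤}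
    (λ y⊑x → 1 , _ , Span⁺-singleton 0 , lift tt)
    (λ {_} {z} _ _ → let i , z∈ = cover z in lose (∈-allFin i) (lift z∈))

  i = proj₁ monochromatic

  result = hindman record
    { K     = colour i
    ; resp  = λ z≈w z∈ → lift (A-resp i z≈w (lower z∈))
    ; seq   = proj₁ (proj₂ monochromatic)
    ; large = proj₂ (proj₂ (proj₂ monochromatic))
    }

  g = proj₁ result

  g⊆A : ∀ {b z} → Span⁺ g 0 b z → colour i z
  g⊆A = proj₂ (proj₂ result)

  -- As a block sequence of a block sequence of `x`, the sequence `g` inherits genericity.
  open Witness g (Generic-⊑ (⊑-trans (proj₁ (proj₂ result)) (proj₁ (proj₂ (proj₂ monochromatic))))
                   (generic-Generic G-infinite))
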